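{- Let $k\ge 1$ and $n\ge 1$ be integers. The distribution of each of the statistics $\mathrm{pk}_0,\mathrm{pk}_1,\dots,\mathrm{pk}_{k-1},\mathrm{dd}$ on $\mathcal{P}^k_n$ is the reversed distribution of $\mathrm{pk}$ on $\mathcal{P}^k_n$; that is, for every $\mathrm{st}\in\{\mathrm{pk}_0,\dots,\mathrm{pk}_{k-1},\mathrm{dd}\}$ and every integer $r$ with $0\le r\le n-1$, the number of $P\in\mathcal{P}^k_n$ with $\mathrm{st}(P)=r$ equals the number of $P\in\mathcal{P}^k_n$ with $\mathrm{pk}(P)=n-1-r$.
   Context: A $k$-Dyck path of down-size $n$ is a lattice path from $(0,0)$ to $((k+1)n,0)$ with steps $u=(1,1)$ and $d=(1,-k)$ that stays in the first quadrant (never goes below the $x$-axis). $\mathcal{P}^k_n$ is the set of all such paths. A peak is a block of two consecutive steps $ud$; its height is the second coordinate of the left endpoint of its $d$ step. A double descent is a block $dd$ of two consecutive steps. $\mathrm{pk}(P)$ is the number of non-rightmost peaks of $P$ (the number of all peaks minus one). For $0\le i\le k-1$, $\mathrm{pk}_i(P)$ is the number of non-rightmost peaks of $P$ whose height is congruent to $i$ modulo $k$; $\mathrm{dd}(P)$ is the number of double descents of $P$. -}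

module Defs where

open import Data.Empty using (⊥)
open import Data.Fin.Base using (Fin; toℕ)
open import Data.Integer.Base as ℤ using (ℤ; +_; 0ℤ; 1ℤ; _%ℕ_)
import Data.Integer.Properties as ℤ
open import Data.List.Base using (List; []; _∷_; _++_; map; filter; foldr; inits; length)
open import Data.List.Membership.Propositional using (_∈_)
open import Data.List.Membership.Propositional.Properties
  using (∈-map⁺; ∈-map⁻; ∈-++⁺ˡ; ∈-++⁺ʳ; ∈-filter⁺; ∈-filter⁻)
open import Data.List.Properties using (∷-injectiveʳ)
open import Data.List.Relation.Unary.All using (All; []; all?)
open import Data.List.Relation.Unary.AllPairs using ([]; _∷_)
open import Data.List.Relation.Unary.Any using (here)
open import Data.List.Relation.Unary.Unique.Propositional using (Unique)
import Data.List.Relation.Unary.Unique.Propositional.Properties as Unique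
open import Data.Nat.Base using (ℕ; zero; suc; _+_; _*_; NonZero)
open import Data.Nat.Properties using (_≟_)
open import Data.Product.Base using (∃; _×_; _,_)
open import Function.Bundles using (_⇔_; mk⇔)
open import Relation.Binary.PropositionalEquality using (_≡_; refl; subst)
open import Relation.Nullary.Decidable using (Dec; _×-dec_)

data Step : Set where
  u d : Step

rise : ℕ → Step → ℤ
rise k u = 1ℤ
rise k d = ℤ.- (+ k)

-- The second coordinate of the endpoint of the path w started at (0,0).
height : ℕ → List Step → ℤ
height k = foldr (λ s h → rise k s ℤ.+ h) 0ℤ

-- Both steps advance the first coordinate by 1, so the first coordinate of
-- the endpoint is the length.  The lattice points on the path are the
-- endpoints of its prefixes.
IsDyck : ℕ → ℕ → List Step → Set
IsDyck k n w = length w ≡ (k + 1) * n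
             × height k w ≡ 0ℤ
             × All (λ v → 0ℤ ℤ.≤ height k v) (inits w)

isDyck? : ∀ k n w → Dec (IsDyck k n w)
isDyck? k n w = (length w ≟ (k + 1) * n)
          ×-dec (height k w ℤ.≟ 0ℤ)
          ×-dec all? (λ v → 0ℤ ℤ.≤? height k v) (inits w)

words : ℕ → List (List Step)
words zero    = [] ∷ []
words (suc m) = map (u ∷_) (words m) ++ map (d ∷_) (words m)

-- The finite set of k-Dyck paths of down-size n, as a list without
-- repetitions; see ∈-𝒫 and 𝒫-unique.
𝒫 : ℕ → ℕ → List (List Step)
𝒫 k n = filter (isDyck? k n) (words ((k + 1) * n))

-- #[ f ≡ r ]∈ xs is the number of x in xs with f x ≡ r.
#[_≡_]∈_ : {A : Set} → (A → ℕ) → ℕ → List A → ℕ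
#[ f ≡ r ]∈ xs = length (filter (λ x → f x ≟ r) xs)

-- The heights of the peaks, from left to right, of the path w started at
-- height h.
peakHeights : ℕ → ℤ → List Step → List ℤ
peakHeights k h []          = []
peakHeights k h (u ∷ d ∷ w) = h ℤ.+ rise k u ∷ peakHeights k (h ℤ.+ rise k u ℤ.+ rise k d) w
peakHeights k h (u ∷ w)     = peakHeights k (h ℤ.+ rise k u) w
peakHeights k h (d ∷ w)     = peakHeights k (h ℤ.+ rise k d) w

dropLast : {A : Set} → List A → List A
dropLast []           = []
dropLast (x ∷ [])     = []
dropLast (x ∷ y ∷ xs) = x ∷ dropLast (y ∷ xs)

nonRightmostPeakHeights : ℕ → List Step → List ℤ
nonRightmostPeakHeights k w = dropLast (peakHeights k 0ℤ w)

pk : ℕ → List Step → ℕ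
pk k w = length (nonRightmostPeakHeights k w)

-- As toℕ i < k, a height is congruent to i modulo k exactly when its
-- remainder is toℕ i.
pkᵢ : ∀ k .{{_ : NonZero k}} → Fin k → List Step → ℕ
pkᵢ k i w = length (filter (λ h → (h %ℕ k) ≟ toℕ i) (nonRightmostPeakHeights k w))

-- Occurrences may overlap: ddd contains two double descents.
dd : List Step → ℕ
dd (d ∷ d ∷ w) = suc (dd (d ∷ w))
dd (_ ∷ w)     = dd w
dd []          = 0

∈-words : ∀ w → w ∈ words (length w)
∈-words []      = here refl
∈-words (u ∷ w) = ∈-++⁺ˡ (∈-map⁺ (u ∷_) (∈-words w))
∈-words (d ∷ w) = ∈-++⁺ʳ (map (u ∷_) (words (length w))) (∈-map⁺ (d ∷_) (∈-words w))

words-unique : ∀ m → Unique (words m)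
words-unique zero    = [] ∷ []
words-unique (suc m) = Unique.++⁺ (Unique.map⁺ ∷-injectiveʳ (words-unique m))
                                  (Unique.map⁺ ∷-injectiveʳ (words-unique m))
  λ (p , q) → disjoint (∈-map⁻ (u ∷_) p) (∈-map⁻ (d ∷_) q)
  where
  disjoint : ∀ {v} → (∃ λ x → x ∈ words m × v ≡ u ∷ x) → (∃ λ x → x ∈ words m × v ≡ d ∷ x) → ⊥
  disjoint (_ , _ , refl) (_ , _ , ())

∈-𝒫 : ∀ k n w → w ∈ 𝒫 k n ⇔ IsDyck k n w
∈-𝒫 k n w = mk⇔ (λ p → let _ , q = ∈-filter⁻ (isDyck? k n) {xs = words ((k + 1) * n)} p in q)
  λ q@(eq , _) → ∈-filter⁺ (isDyck? k n) (subst (λ m → w ∈ words m) eq (∈-words w)) q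

𝒫-unique : ∀ k n → Unique (𝒫 k n)
𝒫-unique k n = Unique.filter⁺ (isDyck? k n) (words-unique ((k + 1) * n))

{-# OPTIONS --safe #-}
module Submission where

-- Cutting a nonempty k-Dyck path P at the last visits to the heights
-- 0, 1, ..., k-1 before its final step gives
--     P = P_0 u P_1 u ... P_{k-1} u P_k d
-- with k-Dyck paths P_j, so paths with n down steps correspond to
-- (k+1)-ary trees with n inner nodes.  Let this factorization occur inside a
-- longer path, at base height h.  Its final d makes a double descent exactly
-- when P_k is nonempty.  For j < k, the u after P_j makes a valley du, at
-- height h + j, exactly when P_j is nonempty.  The last peak before a valley
-- has the same height modulo k as the valley, so the non-rightmost peaks of
-- residue i correspond to the valleys of residue i (count-peaks).  Hence at
-- every node dd tests one of the k+1 children for being nonempty, namely P_k,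
-- and pk_i also tests exactly one, namely the P_j, j < k, with h + j
-- congruent to i modulo k.
-- Exchanging this child with P_k, recursively at all nodes, is a size-preserving
-- bijection that carries pk_i to dd.
--
-- This is proved for any set of marked heights and any weight δ of a double
-- descent such that every k consecutive heights contain exactly 1 - δ marks
-- (Marking).  Marked valleys plus δ times double descents is then
-- equidistributed with the number of nonleaf top children in trees
-- (statistic-equidistributed).  The trees are decoded from words by a stack
-- machine (run), and each statistic is transported one step at a time along a
-- run (topEdges-run, size-run).
--
-- The reversal is pointwise: each d but the last is followed either by d, which
-- is a double descent, or by u, which is a valley, and the valleys are as many
-- as the non-rightmost peaks.  So pk + dd = n - 1 on every path (pk+dd).

open import Defs
open import Data.Bool.Base using (Bool; true; false; if_then_else_)
open import Data.Fin.Base using (Fin; toℕ)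
open import Data.Fin.Properties using (toℕ<n)
open import Data.Integer.Base as ℤ using (ℤ; +_; 0ℤ; 1ℤ; _%ℕ_)
import Data.Integer.Properties as ℤ
open import Data.List.Base using (List; []; _∷_; _++_; drop; filter; inits; length; map)
open import Data.List.Membership.Propositional using (_∈_)
open import Data.List.Membership.Propositional.Properties
  using (∈-filter⁺; ∈-filter⁻; ∈-map⁺; ∈-map⁻)
open import Data.List.Membership.Propositional.Properties.WithK using (unique∧set⇒bag)
open import Data.List.Properties
  using (++-assoc; ++-identityʳ; filter-all; length-drop; length-++; length-map; map-∘; map-id-local)
open import Data.List.Relation.Binary.BagAndSetEquality using (∼bag⇒↭)
open import Data.List.Relation.Binary.Permutation.Propositional.Properties using (↭-length)
open import Data.List.Relation.Unary.All as All using (All; []; _∷_)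
import Data.List.Relation.Unary.All.Properties as All
open import Data.List.Relation.Unary.Unique.Propositional using (Unique)
import Data.List.Relation.Unary.Unique.Propositional.Properties as Unique
open import Data.Nat.Base using (ℕ; zero; suc; _+_; _*_; _∸_; _≤_; _<_; z≤n; s≤s⁻¹; NonZero; ≢-nonZero⁻¹)
open import Data.Nat.DivMod using (_%_; [m+n]%n≡m%n; m<n⇒m%n≡m)
open import Data.Nat.Properties
open import Data.Nat.Tactic.RingSolver using (solve-∀)
open import Data.Product.Base using (_×_; _,_; proj₁; proj₂; uncurry; ∃₂)
open import Data.Unit.Base using (⊤; tt)
open import Data.Vec.Base as Vec using (Vec; []; _∷_; toList)
open import Data.Vec.Properties using (length-toList)
open import Data.Vec.Relation.Binary.Pointwise.Inductive using (Pointwise; []; _∷_)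
open import Function.Base using (id)
open import Function.Bundles using (mk⇔; Equivalence)
open import Relation.Binary.PropositionalEquality
open import Relation.Nullary.Decidable using (Dec; yes; no; does; dec-true; dec-false)
open import Relation.Nullary.Negation using (contradiction)
open ≡-Reasoning

-- Trees and paths

-- (k+1)-ary plane trees: node t ts has the top child t and k further children.
-- In the factorization P_0 u ... P_{k-1} u P_k d, before any exchange, t stands
-- for P_k and ts lists P_{k-1}, ..., P_0 from the highest to the lowest.
data Tree (k : ℕ) : Set where
  leaf : Tree k
  node : Tree k → Vec (Tree k) k → Tree k

nonleaf : ∀ {k} → Tree k → ℕ
nonleaf leaf       = 0
nonleaf (node _ _) = 1

mutual
  -- The number of inner nodes.
  size : ∀ {k} → Tree k → ℕ
  size leaf        = 0
  size (node t ts) = suc (size t + sizes ts)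

  sizes : ∀ {k n} → Vec (Tree k) n → ℕ
  sizes []       = 0
  sizes (t ∷ ts) = size t + sizes ts

mutual
  -- The number of inner nodes whose top child is not a leaf.
  topEdges : ∀ {k} → Tree k → ℕ
  topEdges leaf        = 0
  topEdges (node t ts) = nonleaf t + topEdges t + topEdgess ts

  topEdgess : ∀ {k n} → Vec (Tree k) n → ℕ
  topEdgess []       = 0
  topEdgess (t ∷ ts) = topEdges t + topEdgess ts

-- Descent k h w: the path w, started at height h, ends at height 0 and never
-- goes below the axis.  Heights are natural numbers, so k + h ≡ h′ says that a
-- down step from h′ does not cross the axis.
data Descent (k : ℕ) : ℕ → List Step → Set where
  end  : Descent k 0 []
  up   : ∀ {h w} → Descent k (suc h) w → Descent k h (u ∷ w)
  down : ∀ {h h′ w} → k + h ≡ h′ → Descent k h w → Descent k h′ (d ∷ w)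

-- The number of down steps.
downs : List Step → ℕ
downs []      = 0
downs (u ∷ w) = downs w
downs (d ∷ w) = suc (downs w)

indicator : Bool → ℕ
indicator b = if b then 1 else 0

module _ {k : ℕ} where

  -- The first n entries of a list, filled up with leaves if it is too short.
  -- On the stacks that arise from a path above the axis the filling never occurs.
  pad : ∀ n → List (Tree k) → Vec (Tree k) n
  pad zero    _        = []
  pad (suc n) []       = leaf ∷ pad n []
  pad (suc n) (t ∷ ts) = t ∷ pad n ts

  pad-++ : ∀ {n} (ts : Vec (Tree k) n) rest → pad n (toList ts ++ rest) ≡ ts
  pad-++ []       rest = refl
  pad-++ (t ∷ ts) rest = cong (t ∷_) (pad-++ ts rest)

  drop-toList-++ : ∀ {n} (ts : Vec (Tree k) n) rest → drop n (toList ts ++ rest) ≡ rest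
  drop-toList-++ []       rest = refl
  drop-toList-++ (t ∷ ts) rest = drop-toList-++ ts rest

  pad-drop : ∀ n {h} (rest : List (Tree k)) → length rest ≡ n + h →
             toList (pad n rest) ++ drop n rest ≡ rest
  pad-drop zero    rest       eq = refl
  pad-drop (suc n) (t ∷ rest) eq = cong (t ∷_) (pad-drop n rest (suc-injective eq))

  length-drop-+ : ∀ n {h} (rest : List (Tree k)) → length rest ≡ n + h → length (drop n rest) ≡ h
  length-drop-+ n {h} rest eq = trans (length-drop n rest) (trans (cong (_∸ n) eq) (m+n∸m≡n n h))

  length-toList-++ : ∀ {n} (ts : Vec (Tree k) n) rest → length (toList ts ++ rest) ≡ n + length rest
  length-toList-++ ts rest = trans (length-++ (toList ts)) (cong (_+ length rest) (length-toList ts))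

-- The tree coding of paths, for a set of marked heights

module Coding (k : ℕ) (marked : ℕ → Bool) where

  -- In a factorization with base height h, the head of a vector with a tail of
  -- length n belongs to height n + h.  The top child x changes places with the
  -- first entry at a marked height; if there is none, nothing changes.
  exchange : ∀ {A : Set} {n} → ℕ → A → Vec A n → A × Vec A n
  exchange h x []               = x , []
  exchange h x (_∷_ {n} y ys) with marked (n + h)
  ... | true  = y , x ∷ ys
  ... | false = let z , zs = exchange h x ys in z , y ∷ zs

  exchange-involutive : ∀ {A : Set} {n} h (x : A) (ys : Vec A n) →
    uncurry (exchange h) (exchange h x ys) ≡ (x , ys)
  exchange-involutive h x []               = refl
  exchange-involutive h x (_∷_ {n} y ys) with marked (n + h) in eq
  ... | true  rewrite eq = refl
  ... | false rewrite eq | exchange-involutive h x ys = refl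

  exchange-map : ∀ {A B : Set} (f : A → B) {n} h (x : A) (ys : Vec A n) →
    let z , zs = exchange h x ys in exchange h (f x) (Vec.map f ys) ≡ (f z , Vec.map f zs)
  exchange-map f h x []               = refl
  exchange-map f h x (_∷_ {n} y ys) with marked (n + h)
  ... | true  = refl
  ... | false rewrite exchange-map f h x ys = refl

  -- Parametricity of exchange.
  exchange-related : ∀ {A B : Set} (R : A → B → Set) {n} h {x y} {xs : Vec A n} {ys : Vec B n} →
    R x y → Pointwise R xs ys →
    let z , zs = exchange h x xs ; v , vs = exchange h y ys in R z v × Pointwise R zs vs
  exchange-related R h r []                    = r , []
  exchange-related R h r (_∷_ {n} s rs) with marked (n + h)
  ... | true  = s , r ∷ rs
  ... | false = let q , qs = exchange-related R h r rs in q , s ∷ qs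

  -- The part P_0 u ... P_{n-1} u of a factorization with base height h.  The
  -- factors are functions of the height at which they start, because the positions
  -- of the marks depend on it.
  below : ∀ {n} → ℕ → Vec (ℕ → List Step) n → List Step
  below h []             = []
  below h (_∷_ {n} f fs) = below h fs ++ f (n + h) ++ u ∷ []

  -- The path of a tree, started at height h.  The exchange is performed on the
  -- recursively computed paths, which keeps the recursion structural.
  mutual
    encode : Tree k → ℕ → List Step
    encode leaf        h = []
    encode (node t ts) h = let f , fs = exchange h (encode t) (encodes ts) in
      below h fs ++ f (k + h) ++ d ∷ []

    encodes : ∀ {n} → Vec (Tree k) n → Vec (ℕ → List Step) n
    encodes []       = []
    encodes (t ∷ ts) = encode t ∷ encodes ts

  encodes≡map : ∀ {n} (ts : Vec (Tree k) n) → encodes ts ≡ Vec.map encode ts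
  encodes≡map []       = refl
  encodes≡map (t ∷ ts) = cong (encode t ∷_) (encodes≡map ts)

  -- Decodes a path.  Before a step from height h, the tree x codes the factor that
  -- has just been completed at height h, and rest lists the completed factors at
  -- the heights h-1, ..., 0.  A step u opens an empty factor; a step d joins x and
  -- the topmost k entries of rest into one node.
  run : List Step → Tree k → List (Tree k) → Tree k
  run []      x rest = x
  run (u ∷ w) x rest = run w leaf (x ∷ rest)
  run (d ∷ w) x rest =
    run w (uncurry node (exchange (length (drop k rest)) x (pad k rest))) (drop k rest)

  decode : List Step → Tree k
  decode w = run w leaf []

  -- f behaves like encode t: inserting f h at height h keeps a descent a descent,
  -- and running it there replaces a leaf on top of the stack by t.
  record Encodes (f : ℕ → List Step) (t : Tree k) : Set where
    field
      descent : ∀ h {w} → Descent k h w → Descent k h (f h ++ w)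
      decodes : ∀ {h} rest w → length rest ≡ h → run (f h ++ w) leaf rest ≡ run w t rest
  open Encodes

  below-descent : ∀ {n} {fs : Vec _ n} {ts : Vec _ n} → Pointwise Encodes fs ts →
    ∀ h {w} → Descent k (n + h) w → Descent k h (below h fs ++ w)
  below-descent []                   h p = p
  below-descent (_∷_ {n} {x = f} {xs = fs} e es) h {w} p =
    subst (Descent k h) (trans (cong (below h fs ++_) (sym (++-assoc (f (n + h)) _ w)))
                               (sym (++-assoc (below h fs) _ w)))
      (below-descent es h (descent e (n + h) (up p)))

  below-decodes : ∀ {n} {fs : Vec _ n} {ts : Vec _ n} → Pointwise Encodes fs ts →
    ∀ rest w → run (below (length rest) fs ++ w) leaf rest ≡ run w leaf (toList ts ++ rest)
  below-decodes []                   rest w = refl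
  below-decodes (_∷_ {n} {x = f} {y = t} {xs = fs} {ys = ts} e es) rest w = begin
    run ((below h fs ++ f (n + h) ++ u ∷ []) ++ w) leaf rest
      ≡⟨ cong (λ v → run v leaf rest)
           (trans (++-assoc (below h fs) _ w) (cong (below h fs ++_) (++-assoc (f (n + h)) _ w))) ⟩
    run (below h fs ++ f (n + h) ++ u ∷ w) leaf rest
      ≡⟨ below-decodes es rest _ ⟩
    run (f (n + h) ++ u ∷ w) leaf (toList ts ++ rest)
      ≡⟨ decodes e _ _ (length-toList-++ ts rest) ⟩
    run w leaf (t ∷ toList ts ++ rest) ∎
    where h = length rest

  run-down : ∀ w x (ts : Vec (Tree k) k) rest →
    run (d ∷ w) x (toList ts ++ rest) ≡ run w (uncurry node (exchange (length rest) x ts)) rest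
  run-down w x ts rest rewrite pad-++ ts rest | drop-toList-++ ts rest = refl

  mutual
    encode-encodes : ∀ t → Encodes (encode t) t
    encode-encodes leaf = record { descent = λ h p → p ; decodes = λ rest w eq → refl }
    encode-encodes (node t ts) = record
      { descent = λ h {w} p →
          let e , es = exchange-related Encodes h (encode-encodes t) (encodes-encodes ts) in
          subst (Descent k h) (sym (reassoc h w))
            (below-descent es h (descent e (k + h) (down refl p)))
      ; decodes = λ { rest w refl →
          let h = length rest
              e , es = exchange-related Encodes h (encode-encodes t) (encodes-encodes ts)
              y , ys = exchange h t ts
          in begin
            run (encode (node t ts) h ++ w) leaf rest
              ≡⟨ cong (λ v → run v leaf rest) (reassoc h w) ⟩
            _
              ≡⟨ below-decodes es rest _ ⟩
            _
              ≡⟨ decodes e _ _ (length-toList-++ ys rest) ⟩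
            run (d ∷ w) y (toList ys ++ rest)
              ≡⟨ run-down w y ys rest ⟩
            run w (uncurry node (exchange h y ys)) rest
              ≡⟨ cong (λ p → run w (uncurry node p) rest) (exchange-involutive h t ts) ⟩
            run w (node t ts) rest ∎ }
      }
      where
      reassoc : ∀ h w → let f , fs = exchange h (encode t) (encodes ts) in
        encode (node t ts) h ++ w ≡ below h fs ++ f (k + h) ++ d ∷ w
      reassoc h w = let f , fs = exchange h (encode t) (encodes ts) in
        trans (++-assoc (below h fs) _ w) (cong (below h fs ++_) (++-assoc (f (k + h)) _ w))

    encodes-encodes : ∀ {n} (ts : Vec (Tree k) n) → Pointwise Encodes (encodes ts) ts
    encodes-encodes []       = []
    encodes-encodes (t ∷ ts) = encode-encodes t ∷ encodes-encodes ts

  encode-descent : ∀ t → Descent k 0 (encode t 0)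
  encode-descent t = subst (Descent k 0) (++-identityʳ _) (descent (encode-encodes t) 0 end)

  decode-encode : ∀ t → decode (encode t 0) ≡ t
  decode-encode t = trans (cong decode (sym (++-identityʳ (encode t 0))))
                          (decodes (encode-encodes t) [] [] refl)

  -- The two exchanges, in the node and in its coding, cancel.
  encode-exchange : ∀ h x (ts : Vec (Tree k) k) →
    encode (uncurry node (exchange h x ts)) h ≡ below h (encodes ts) ++ encode x (k + h) ++ d ∷ []
  encode-exchange h x ts = cong (λ (f , fs) → below h fs ++ f (k + h) ++ d ∷ []) (begin
    exchange h (encode y) (encodes ys)           ≡⟨ cong (exchange h (encode y)) (encodes≡map ys) ⟩
    exchange h (encode y) (Vec.map encode ys)    ≡⟨ cong (uncurry (exchange h)) (exchange-map encode h x ts) ⟨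
    uncurry (exchange h) (exchange h (encode x) (Vec.map encode ts))
                                                 ≡⟨ exchange-involutive h _ _ ⟩
    encode x , Vec.map encode ts                 ≡⟨ cong (encode x ,_) (encodes≡map ts) ⟨
    encode x , encodes ts                        ∎)
    where
    y  = proj₁ (exchange h x ts)
    ys = proj₂ (exchange h x ts)

  -- The path coded by the part of the stack below the top tree.
  belowList : List (Tree k) → List Step
  belowList []       = []
  belowList (t ∷ ts) = belowList ts ++ encode t (length ts) ++ u ∷ []

  belowList-++ : ∀ {n} (ts : Vec (Tree k) n) rest →
    belowList (toList ts ++ rest) ≡ belowList rest ++ below (length rest) (encodes ts)
  belowList-++ []             rest = sym (++-identityʳ _)
  belowList-++ (_∷_ {n} t ts) rest = trans
    (cong₂ (λ v h → v ++ encode t h ++ u ∷ []) (belowList-++ ts rest) (length-toList-++ ts rest))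
    (++-assoc (belowList rest) _ _)

  -- At every moment the stack codes the part of the path already read.
  encode-run : ∀ {h w} → Descent k h w → ∀ x rest → length rest ≡ h →
    encode (run w x rest) 0 ≡ (belowList rest ++ encode x h) ++ w
  encode-run end x [] eq = sym (++-identityʳ _)
  encode-run (up {w = w} p) x rest refl = begin
    encode (run w leaf (x ∷ rest)) 0  ≡⟨ encode-run p leaf (x ∷ rest) refl ⟩
    ((b ++ e ++ u ∷ []) ++ []) ++ w   ≡⟨ cong (_++ w) (++-identityʳ _) ⟩
    (b ++ e ++ u ∷ []) ++ w           ≡⟨ cong (_++ w) (++-assoc b e _) ⟨
    ((b ++ e) ++ u ∷ []) ++ w         ≡⟨ ++-assoc (b ++ e) _ w ⟩
    (b ++ e) ++ u ∷ w                 ∎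
    where b = belowList rest
          e = encode x (length rest)
  encode-run (down {h} {w = w} refl p) x rest eq = begin
    encode (run (d ∷ w) x rest) 0
      ≡⟨ encode-run p _ below-rest length-below ⟩
    (belowList below-rest ++ encode (uncurry node (exchange (length below-rest) x ts)) h) ++ w
      ≡⟨ cong (λ l → (belowList below-rest ++ encode (uncurry node (exchange l x ts)) h) ++ w) length-below ⟩
    (b ++ encode (uncurry node (exchange h x ts)) h) ++ w
      ≡⟨ cong (λ v → (b ++ v) ++ w) (encode-exchange h x ts) ⟩
    (b ++ c ++ e ++ d ∷ []) ++ w
      ≡⟨ cong (_++ w) (++-assoc b c _) ⟨
    ((b ++ c) ++ e ++ d ∷ []) ++ w
      ≡⟨ cong (_++ w) (++-assoc (b ++ c) e _) ⟨
    (((b ++ c) ++ e) ++ d ∷ []) ++ w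
      ≡⟨ ++-assoc ((b ++ c) ++ e) _ w ⟩
    ((b ++ c) ++ e) ++ d ∷ w
      ≡⟨ cong (λ l → ((b ++ below l (encodes ts)) ++ e) ++ d ∷ w) length-below ⟨
    ((b ++ below (length below-rest) (encodes ts)) ++ e) ++ d ∷ w
      ≡⟨ cong (λ v → (v ++ e) ++ d ∷ w) (belowList-++ ts below-rest) ⟨
    (belowList (toList ts ++ below-rest) ++ e) ++ d ∷ w
      ≡⟨ cong (λ l → (belowList l ++ e) ++ d ∷ w) (pad-drop k rest eq) ⟩
    (belowList rest ++ e) ++ d ∷ w ∎
    where
    below-rest = drop k rest
    ts = pad k rest
    length-below : length below-rest ≡ h
    length-below = length-drop-+ k rest eq
    b = belowList below-rest
    c = below h (encodes ts)
    e = encode x (k + h)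

  encode-decode : ∀ {w} → Descent k 0 w → encode (decode w) 0 ≡ w
  encode-decode p = encode-run p leaf [] refl

  size-exchange : ∀ {n} h x (ts : Vec (Tree k) n) →
    let y , ys = exchange h x ts in size y + sizes ys ≡ size x + sizes ts
  size-exchange h x []               = refl
  size-exchange h x (_∷_ {n} t ts) with marked (n + h)
  ... | true  = swap (size x) (size t) (sizes ts)
    where
    swap : ∀ a b c → b + (a + c) ≡ a + (b + c)
    swap = solve-∀
  ... | false = let y , ys = exchange h x ts in begin
    size y + (size t + sizes ys)  ≡⟨ swap (size y) (size t) (sizes ys) ⟩
    size t + (size y + sizes ys)  ≡⟨ cong (_+_ (size t)) (size-exchange h x ts) ⟩
    size t + (size x + sizes ts)  ≡⟨ swap (size t) (size x) (sizes ts) ⟩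
    size x + (size t + sizes ts)  ∎
    where
    swap : ∀ a b c → a + (b + c) ≡ b + (a + c)
    swap = solve-∀

  sizes-++ : ∀ {n} (ts : Vec (Tree k) n) rest →
    sizes (Vec.fromList (toList ts ++ rest)) ≡ sizes ts + sizes (Vec.fromList rest)
  sizes-++ []       rest = refl
  sizes-++ (t ∷ ts) rest = trans (cong (_+_ (size t)) (sizes-++ ts rest)) (sym (+-assoc (size t) _ _))

  -- A step d joins k+1 trees of the stack into one, which has one more inner node.
  size-run : ∀ {h w} → Descent k h w → ∀ x rest → length rest ≡ h →
    size (run w x rest) ≡ size x + sizes (Vec.fromList rest) + downs w
  size-run end x [] eq = sym (trans (+-identityʳ _) (+-identityʳ _))
  size-run (up p) x rest eq = size-run p leaf (x ∷ rest) (cong suc eq)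
  size-run (down {h} {w = w} refl p) x rest eq = begin
    size (run (d ∷ w) x rest)
      ≡⟨ size-run p _ below-rest length-below ⟩
    suc (size y + sizes ys) + sizes (Vec.fromList below-rest) + downs w
      ≡⟨ cong (λ v → suc v + sizes (Vec.fromList below-rest) + downs w) (size-exchange _ x ts) ⟩
    suc (size x + sizes ts) + sizes (Vec.fromList below-rest) + downs w
      ≡⟨ rearrange (size x) (sizes ts) _ (downs w) ⟩
    size x + (sizes ts + sizes (Vec.fromList below-rest)) + suc (downs w)
      ≡⟨ cong (λ v → size x + v + suc (downs w)) (sizes-++ ts below-rest) ⟨
    size x + sizes (Vec.fromList (toList ts ++ below-rest)) + suc (downs w)
      ≡⟨ cong (λ v → size x + sizes (Vec.fromList v) + suc (downs w)) (pad-drop k rest eq) ⟩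
    size x + sizes (Vec.fromList rest) + suc (downs w) ∎
    where
    below-rest = drop k rest
    ts = pad k rest
    y  = proj₁ (exchange (length below-rest) x ts)
    ys = proj₂ (exchange (length below-rest) x ts)
    length-below : length below-rest ≡ h
    length-below = length-drop-+ k rest eq
    rearrange : ∀ a b c e → suc (a + b) + c + e ≡ a + (b + c) + suc e
    rearrange = solve-∀

  size-decode : ∀ {w} → Descent k 0 w → size (decode w) ≡ downs w
  size-decode p = size-run p leaf [] refl

  downs-encode : ∀ t → downs (encode t 0) ≡ size t
  downs-encode t = trans (sym (size-decode (encode-descent t))) (cong size (decode-encode t))

-- Statistics along a run

  mark : ℕ → ℕ
  mark h = indicator (marked h)

  -- The number of marked heights among h, ..., h + n - 1.
  marks : ℕ → ℕ → ℕ
  marks h zero    = 0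
  marks h (suc n) = mark (n + h) + marks h n

  -- What the trees ts, at the heights h, ..., h + n - 1, contribute while they lie
  -- on the stack: their own top edges and, as each is followed by a step u, one
  -- valley for each that is not a leaf and belongs to a marked height.
  pending : ∀ {n} → ℕ → Vec (Tree k) n → ℕ
  pending h []               = 0
  pending h (_∷_ {n} t ts) = mark (n + h) * nonleaf t + topEdges t + pending h ts

  pending-unmarked : ∀ {n} h (ts : Vec (Tree k) n) → marks h n ≡ 0 → pending h ts ≡ topEdgess ts
  pending-unmarked h []             eq = refl
  pending-unmarked h (_∷_ {n} t ts) eq
    rewrite m+n≡0⇒m≡0 (mark (n + h)) eq =
    cong (_+_ (topEdges t)) (pending-unmarked h ts (m+n≡0⇒n≡0 (mark (n + h)) eq))

  pendingList : List (Tree k) → ℕ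
  pendingList rest = pending 0 (Vec.fromList rest)

  pending-++ : ∀ {n} (ts : Vec (Tree k) n) rest →
    pendingList (toList ts ++ rest) ≡ pending (length rest) ts + pendingList rest
  pending-++ []             rest = refl
  pending-++ (_∷_ {n} t ts) rest = begin
    mark (length (toList ts ++ rest) + 0) * nonleaf t + topEdges t + pendingList (toList ts ++ rest)
      ≡⟨ cong₂ (λ l v → mark l * nonleaf t + topEdges t + v)
           (trans (+-identityʳ _) (length-toList-++ ts rest)) (pending-++ ts rest) ⟩
    mark (n + length rest) * nonleaf t + topEdges t + (pending (length rest) ts + pendingList rest)
      ≡⟨ +-assoc (mark (n + length rest) * nonleaf t + topEdges t) _ _ ⟨
    mark (n + length rest) * nonleaf t + topEdges t + pending (length rest) ts + pendingList rest ∎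

  module Statistic (δ : ℕ) where

    -- The number of valleys du at marked heights plus δ times the number of double
    -- descents, for a path started at height h; b is 1 when the step before is a d,
    -- and 0 otherwise.  The truncated h ∸ k matters only below the axis.
    scan : ℕ → ℕ → List Step → ℕ
    scan b h []      = 0
    scan b h (u ∷ w) = mark h * b + scan 0 (suc h) w
    scan b h (d ∷ w) = δ * b + scan 1 (h ∸ k) w

    -- Exactly one tree among x and ts is tested for being a leaf: x if δ is 1, or
    -- else the one at the marked height.  The exchange moves it to the top.
    topEdges-exchange : ∀ {n} h x (ts : Vec (Tree k) n) → marks h n + δ ≡ 1 →
      let y , ys = exchange h x ts in
      nonleaf y + topEdges y + topEdgess ys ≡ topEdges x + pending h ts + δ * nonleaf x
    topEdges-exchange h x [] refl = rearrange (nonleaf x) (topEdges x)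
      where
      rearrange : ∀ a b → a + b + 0 ≡ b + 0 + (a + 0)
      rearrange = solve-∀
    topEdges-exchange h x (_∷_ {n} t ts) eq with marked (n + h)
    ... | true
      rewrite m+n≡0⇒n≡0 (marks h n) (suc-injective eq)
            | pending-unmarked h ts (m+n≡0⇒m≡0 (marks h n) (suc-injective eq)) =
      rearrange (nonleaf t) (topEdges t) (topEdges x) (topEdgess ts)
      where
      rearrange : ∀ a b c e → a + b + (c + e) ≡ c + (a + 0 + b + e) + 0
      rearrange = solve-∀
    ... | false = let y , ys = exchange h x ts in begin
      nonleaf y + topEdges y + (topEdges t + topEdgess ys)
        ≡⟨ swap (nonleaf y + topEdges y) (topEdges t) (topEdgess ys) ⟩
      topEdges t + (nonleaf y + topEdges y + topEdgess ys)
        ≡⟨ cong (_+_ (topEdges t)) (topEdges-exchange h x ts eq) ⟩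
      topEdges t + (topEdges x + pending h ts + δ * nonleaf x)
        ≡⟨ rearrange (topEdges t) (topEdges x) (pending h ts) (δ * nonleaf x) ⟩
      topEdges x + (topEdges t + pending h ts) + δ * nonleaf x ∎
      where
      swap : ∀ a b c → a + (b + c) ≡ b + (a + c)
      swap = solve-∀
      rearrange : ∀ a b c e → a + (b + c + e) ≡ b + (a + c) + e
      rearrange = solve-∀

    -- The last step read was a d exactly when the top tree x is not a leaf, so
    -- nonleaf x is the flag of the scan.
    topEdges-run : (∀ h → marks h k + δ ≡ 1) →
      ∀ {h w} → Descent k h w → ∀ x rest → length rest ≡ h →
      topEdges (run w x rest) ≡ topEdges x + pendingList rest + scan (nonleaf x) h w
    topEdges-run once end x [] eq = sym (trans (+-identityʳ _) (+-identityʳ _))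
    topEdges-run once (up {h} {w} p) x rest refl = begin
      topEdges (run w leaf (x ∷ rest))
        ≡⟨ topEdges-run once p leaf (x ∷ rest) refl ⟩
      mark (h + 0) * nonleaf x + topEdges x + pendingList rest + scan 0 (suc h) w
        ≡⟨ cong (λ l → mark l * nonleaf x + topEdges x + pendingList rest + scan 0 (suc h) w) (+-identityʳ h) ⟩
      mark h * nonleaf x + topEdges x + pendingList rest + scan 0 (suc h) w
        ≡⟨ rearrange (mark h * nonleaf x) (topEdges x) _ _ ⟩
      topEdges x + pendingList rest + (mark h * nonleaf x + scan 0 (suc h) w) ∎
      where
      rearrange : ∀ a b c e → a + b + c + e ≡ b + c + (a + e)
      rearrange = solve-∀
    topEdges-run once (down {h} {w = w} refl p) x rest eq = begin
      topEdges (run (d ∷ w) x rest)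
        ≡⟨ topEdges-run once p _ below-rest length-below ⟩
      nonleaf y + topEdges y + topEdgess ys + pendingList below-rest + scan 1 h w
        ≡⟨ cong (λ v → v + pendingList below-rest + scan 1 h w) (topEdges-exchange l x ts (once l)) ⟩
      topEdges x + pending l ts + δ * nonleaf x + pendingList below-rest + scan 1 h w
        ≡⟨ rearrange (topEdges x) (pending l ts) (δ * nonleaf x) (pendingList below-rest) (scan 1 h w) ⟩
      topEdges x + (pending l ts + pendingList below-rest) + (δ * nonleaf x + scan 1 h w)
        ≡⟨ cong (λ v → topEdges x + v + (δ * nonleaf x + scan 1 h w)) (pending-++ ts below-rest) ⟨
      topEdges x + pendingList (toList ts ++ below-rest) + (δ * nonleaf x + scan 1 h w)
        ≡⟨ cong₂ (λ v h′ → topEdges x + pendingList v + (δ * nonleaf x + scan 1 h′ w))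
             (pad-drop k rest eq) (sym (m+n∸m≡n k h)) ⟩
      topEdges x + pendingList rest + (δ * nonleaf x + scan 1 (k + h ∸ k) w) ∎
      where
      below-rest = drop k rest
      l  = length below-rest
      ts = pad k rest
      y  = proj₁ (exchange l x ts)
      ys = proj₂ (exchange l x ts)
      length-below : l ≡ h
      length-below = length-drop-+ k rest eq
      rearrange : ∀ a b c e f → a + b + c + e + f ≡ a + (b + e) + (c + f)
      rearrange = solve-∀

    topEdges-decode : (∀ h → marks h k + δ ≡ 1) →
      ∀ {w} → Descent k 0 w → topEdges (decode w) ≡ scan 0 0 w
    topEdges-decode once p = topEdges-run once p leaf [] refl

    scan-encode : (∀ h → marks h k + δ ≡ 1) → ∀ t → scan 0 0 (encode t 0) ≡ topEdges t
    scan-encode once t =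
      trans (sym (topEdges-decode once (encode-descent t))) (cong topEdges (decode-encode t))

-- Dyck paths as descents from height 0

module _ {k : ℕ} where

  up-height : ∀ h v → + h ℤ.+ height k (u ∷ v) ≡ + suc h ℤ.+ height k v
  up-height h v = trans (sym (ℤ.+-assoc (+ h) 1ℤ (height k v)))
                        (cong (λ l → + l ℤ.+ height k v) (+-comm h 1))

  after-down : ∀ h → + (k + h) ℤ.- + k ≡ + h
  after-down h = trans (ℤ.m-n≡m⊖n (k + h) k)
                       (trans (ℤ.⊖-≥ (m≤m+n k h)) (cong +_ (m+n∸m≡n k h)))

  down-height : ∀ h v → + (k + h) ℤ.+ height k (d ∷ v) ≡ + h ℤ.+ height k v
  down-height h v = trans (sym (ℤ.+-assoc (+ (k + h)) (ℤ.- + k) (height k v)))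
                          (cong (ℤ._+ height k v) (after-down h))

  descent-ends : ∀ {h w} → Descent k h w → + h ℤ.+ height k w ≡ 0ℤ
  descent-ends end                       = refl
  descent-ends (up {h} {w} p)            = trans (up-height h w) (descent-ends p)
  descent-ends (down {h} {w = w} refl p) = trans (down-height h w) (descent-ends p)

  -- The path w started at height h never goes below the axis.
  NonNegative : ℕ → List Step → Set
  NonNegative h w = All (λ v → 0ℤ ℤ.≤ + h ℤ.+ height k v) (inits w)

  descent-nonNegative : ∀ {h w} → Descent k h w → NonNegative h w
  descent-nonNegative end        = ℤ.+≤+ z≤n ∷ []
  descent-nonNegative (up {h} p) = ℤ.+≤+ z≤n ∷
    All.map⁺ (All.map (λ {v} → subst (0ℤ ℤ.≤_) (sym (up-height h v))) (descent-nonNegative p))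
  descent-nonNegative (down {h} refl p) = ℤ.+≤+ z≤n ∷
    All.map⁺ (All.map (λ {v} → subst (0ℤ ℤ.≤_) (sym (down-height h v))) (descent-nonNegative p))

  toDescent : ∀ h w → + h ℤ.+ height k w ≡ 0ℤ → NonNegative h w → Descent k h w
  toDescent h [] eq nn with refl ← ℤ.+-injective (trans (sym (ℤ.+-identityʳ (+ h))) eq) = end
  toDescent h (u ∷ w) eq (_ ∷ nn) = up (toDescent (suc h) w
    (trans (sym (up-height h w)) eq)
    (All.map (λ {v} → subst (0ℤ ℤ.≤_) (up-height h v)) (All.map⁻ nn)))
  toDescent h (d ∷ w) eq (_ ∷ nn@(0≤h-k ∷ _)) = down (m+[n∸m]≡n k≤h) (toDescent (h ∸ k) w
    (trans (sym (shift w)) eq)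
    (All.map (λ {v} → subst (0ℤ ℤ.≤_) (shift v)) (All.map⁻ nn)))
    where
    k≤h : k ≤ h
    k≤h = ℤ.drop‿+≤+ (ℤ.0≤i-j⇒j≤i
      (subst (λ z → 0ℤ ℤ.≤ + h ℤ.+ z) (ℤ.+-identityʳ (ℤ.- + k)) 0≤h-k))
    shift : ∀ v → + h ℤ.+ height k (d ∷ v) ≡ + (h ∸ k) ℤ.+ height k v
    shift v = trans (cong (λ l → + l ℤ.+ height k (d ∷ v)) (sym (m+[n∸m]≡n k≤h)))
                    (down-height (h ∸ k) v)

  length-descent : ∀ {h w} → Descent k h w → h + length w ≡ (k + 1) * downs w
  length-descent end                       = sym (*-zeroʳ (k + 1))
  length-descent (up {h} p)                = trans (+-suc h _) (length-descent p)
  length-descent (down {h} {w = w} refl p) = begin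
    k + h + suc (length w)         ≡⟨ rearrange k h (length w) ⟩
    k + 1 + (h + length w)         ≡⟨ cong (_+_ (k + 1)) (length-descent p) ⟩
    k + 1 + (k + 1) * downs w      ≡⟨ *-suc (k + 1) (downs w) ⟨
    (k + 1) * suc (downs w)        ∎
    where
    rearrange : ∀ a b c → a + b + suc c ≡ a + 1 + (b + c)
    rearrange = solve-∀

-- k-Dyck paths of down-size n, described by descents.
IsDescent : ℕ → ℕ → List Step → Set
IsDescent k n w = Descent k 0 w × downs w ≡ n

∈𝒫⇒descent : ∀ {k n w} → w ∈ 𝒫 k n → IsDescent k n w
∈𝒫⇒descent {k} {n} {w} w∈ =
  let len , ends , nn = Equivalence.to (∈-𝒫 k n w) w∈
      p = toDescent 0 w (trans (ℤ.+-identityˡ _) ends)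
                        (All.map (subst (0ℤ ℤ.≤_) (sym (ℤ.+-identityˡ _))) nn)
      eq = trans (cong (_* downs w) (+-comm 1 k))
             (trans (sym (length-descent p)) (trans len (cong (_* n) (+-comm k 1))))
  in p , *-cancelˡ-≡ (downs w) n (suc k) eq

descent⇒∈𝒫 : ∀ {k n w} → IsDescent k n w → w ∈ 𝒫 k n
descent⇒∈𝒫 {k} {n} {w} (p , refl) = Equivalence.from (∈-𝒫 k n w)
  ( length-descent p
  , trans (sym (ℤ.+-identityˡ _)) (descent-ends p)
  , All.map (subst (0ℤ ℤ.≤_) (ℤ.+-identityˡ _)) (descent-nonNegative p))

-- Peaks, valleys and double descents

open Coding using (marks)
open Coding.Statistic using (scan)

-- Peaks whose height has a property P that is invariant under adding k.
module Peaks (k : ℕ) {P : ℤ → Set} (P? : ∀ z → Dec (P z))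
             (periodic : ∀ h → does (P? (+ (k + h))) ≡ does (P? (+ h))) where

  marked : ℕ → Bool
  marked h = does (P? (+ h))

  count : List ℤ → ℕ
  count zs = length (filter P? zs)

  count-∷ : ∀ z zs → count (z ∷ zs) ≡ indicator (does (P? z)) + count zs
  count-∷ z zs with does (P? z)
  ... | true  = refl
  ... | false = refl

  valleys : ℕ → ℕ → List Step → ℕ
  valleys = scan k marked 0

  mutual
    -- The peak z is still to be counted: it is non-rightmost exactly if the descent
    -- has a further step u after its initial steps d, which then makes a valley at a
    -- height with the same property.
    count-after-peak : ∀ {h w} → Descent k h w → ∀ z → does (P? z) ≡ marked h →
      count (dropLast (z ∷ peakHeights k (+ h) w)) ≡ valleys 1 h w
    count-after-peak end z eq = refl
    count-after-peak (up {h} {w} p) z eq with peakHeights k (+ h) (u ∷ w) | count-after-up p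
    ... | _ | z′ , zs , refl , ih = begin
      count (z ∷ dropLast (z′ ∷ zs))                            ≡⟨ count-∷ z _ ⟩
      indicator (does (P? z)) + count (dropLast (z′ ∷ zs))      ≡⟨ cong₂ _+_ (cong indicator eq) ih ⟩
      indicator (marked h) + valleys 0 (suc h) w
        ≡⟨ cong (_+ valleys 0 (suc h) w) (*-identityʳ (indicator (marked h))) ⟨
      indicator (marked h) * 1 + valleys 0 (suc h) w            ∎
    count-after-peak (down {h} refl p) z eq rewrite after-down {k} h | m+n∸m≡n k h =
      count-after-peak p z (trans eq (periodic h))

    -- After a step u a descent still has a peak, so the peak heights z ∷ zs are
    -- not empty; the flag of the scan is 0 because the last step was not a d.
    count-after-up : ∀ {h w} → Descent k (suc h) w → ∃₂ λ z zs →
      peakHeights k (+ h) (u ∷ w) ≡ z ∷ zs × count (dropLast (z ∷ zs)) ≡ valleys 0 (suc h) w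
    count-after-up {h} (up {w = w} p)
      rewrite +-comm h 1 | *-zeroʳ (indicator (marked (suc h))) = count-after-up p
    count-after-up {h} (down {h′} eq p)
      rewrite +-comm h 1 | sym eq | after-down {k} h′ | m+n∸m≡n k h′ =
      _ , _ , refl , count-after-peak p (+ (k + h′)) (periodic h′)

  count-peaks : .{{_ : NonZero k}} → ∀ {w} → Descent k 0 w →
    count (nonRightmostPeakHeights k w) ≡ valleys 0 0 w
  count-peaks end = refl
  count-peaks (up {w = w} p) with peakHeights k 0ℤ (u ∷ w) | count-after-up p
  ... | _ | z , zs , refl , ih rewrite *-zeroʳ (indicator (marked 0)) = ih
  count-peaks (down eq p) = contradiction (m+n≡0⇒m≡0 k eq) (≢-nonZero⁻¹ k)

-- The markings of all heights and of none.
everyLevel noLevel : ℕ → Bool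
everyLevel _ = true
noLevel    _ = false

module _ (k : ℕ) where

  doubleDescents : ℕ → ℕ → List Step → ℕ
  doubleDescents = scan k noLevel 1

  -- With no height marked, the scan does not depend on the starting height.
  mutual
    dd-scan : ∀ h w → dd w ≡ doubleDescents 0 h w
    dd-scan h []      = refl
    dd-scan h (u ∷ w) = dd-scan (suc h) w
    dd-scan h (d ∷ w) = dd-scan-d (h ∸ k) w

    dd-scan-d : ∀ h w → dd (d ∷ w) ≡ doubleDescents 1 h w
    dd-scan-d h []      = refl
    dd-scan-d h (u ∷ w) = dd-scan (suc h) w
    dd-scan-d h (d ∷ w) = cong suc (dd-scan-d (h ∸ k) w)

  mutual
    -- Every d of the path d ∷ w except the last is followed by a u or by a d.
    valleys+dd-d : ∀ {h w} → Descent k h w → scan k everyLevel 0 1 h w + dd (d ∷ w) ≡ downs w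
    valleys+dd-d end                = refl
    valleys+dd-d (up p)             = valleys+dd-u p
    valleys+dd-d (down {h} {w = w} refl p) rewrite m+n∸m≡n k h =
      trans (+-suc _ (dd (d ∷ w))) (cong suc (valleys+dd-d p))

    -- After a step u, w has at least one step d, and the last one is not counted.
    valleys+dd-u : ∀ {h w} → Descent k (suc h) w →
      suc (scan k everyLevel 0 0 (suc h) w + dd w) ≡ downs w
    valleys+dd-u (up p) = valleys+dd-u p
    valleys+dd-u (down {h} eq p) rewrite sym eq | m+n∸m≡n k h = cong suc (valleys+dd-d p)

  pk+dd : .{{_ : NonZero k}} → ∀ {n w} .{{_ : NonZero n}} → IsDescent k n w → pk k w + dd w ≡ n ∸ 1
  pk+dd (end , refl) = refl
  pk+dd {n} {w} (p@(up q) , eq) = begin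
    pk k w + dd w
      ≡⟨ cong (λ zs → length zs + dd w)
           (filter-all All? (All.universal (λ _ → tt) (nonRightmostPeakHeights k w))) ⟨
    count (nonRightmostPeakHeights k w) + dd w
      ≡⟨ cong (_+ dd w) (count-peaks p) ⟩
    scan k everyLevel 0 0 0 w + dd w
      ≡⟨ cong (_∸ 1) (trans (valleys+dd-u q) eq) ⟩
    n ∸ 1 ∎
    where
    -- Every peak is counted.
    All? : (z : ℤ) → Dec ⊤
    All? _ = yes tt
    open Peaks k {P = λ _ → ⊤} All? (λ _ → refl)
  pk+dd (down eq p , _) = contradiction (m+n≡0⇒m≡0 k eq) (≢-nonZero⁻¹ k)

-- Heights of a given residue

module Residue (k : ℕ) .{{_ : NonZero k}} (i : Fin k) where

  residue? : ∀ z → Dec (z %ℕ k ≡ toℕ i)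
  residue? z = z %ℕ k ≟ toℕ i

  marked : ℕ → Bool
  marked h = does (residue? (+ h))

  periodic : ∀ h → marked (k + h) ≡ marked h
  periodic h = cong (λ m → does (m ≟ toℕ i)) (trans (cong (_% k) (+-comm k h)) ([m+n]%n≡m%n h k))

  -- Both sides count the marks among h, ..., h + n.
  marks-shift : ∀ h n →
    marks k marked (suc h) n + indicator (marked h) ≡ indicator (marked (n + h)) + marks k marked h n
  marks-shift h zero    = +-comm 0 _
  marks-shift h (suc n) = begin
    indicator (marked (n + suc h)) + marks k marked (suc h) n + indicator (marked h)
      ≡⟨ +-assoc (indicator (marked (n + suc h))) _ _ ⟩
    indicator (marked (n + suc h)) + (marks k marked (suc h) n + indicator (marked h))
      ≡⟨ cong₂ (λ l m → indicator (marked l) + m) (+-suc n h) (marks-shift h n) ⟩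
    indicator (marked (suc n + h)) + marks k marked h (suc n) ∎

  marks-none : ∀ n → n ≤ toℕ i → marks k marked 0 n ≡ 0
  marks-none zero    n≤i = refl
  marks-none (suc n) n<i
    rewrite +-identityʳ n | m<n⇒m%n≡m (<-trans n<i (toℕ<n i))
          | dec-false (n ≟ toℕ i) (<⇒≢ n<i) = marks-none n (<⇒≤ n<i)

  marks-one : ∀ n → toℕ i < n → n ≤ k → marks k marked 0 n ≡ 1
  marks-one (suc n) i<n n<k with n ≟ toℕ i
  ... | yes refl
    rewrite +-identityʳ n | m<n⇒m%n≡m n<k
          | dec-true (toℕ i ≟ toℕ i) refl = cong suc (marks-none (toℕ i) ≤-refl)
  ... | no n≢i
    rewrite +-identityʳ n | m<n⇒m%n≡m n<k
          | dec-false (n ≟ toℕ i) n≢i =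
    marks-one n (≤∧≢⇒< (s≤s⁻¹ i<n) (≢-sym n≢i)) (<⇒≤ n<k)

  -- Every k consecutive heights contain exactly one of residue i.
  marks-window : ∀ h → marks k marked h k ≡ 1
  marks-window zero    = marks-one k (toℕ<n i) ≤-refl
  marks-window (suc h) = +-cancelʳ-≡ (indicator (marked h)) _ _ (begin
    marks k marked (suc h) k + indicator (marked h)
      ≡⟨ marks-shift h k ⟩
    indicator (marked (k + h)) + marks k marked h k
      ≡⟨ cong₂ (λ b m → indicator b + m) (periodic h) (marks-window h) ⟩
    indicator (marked h) + 1
      ≡⟨ +-comm _ 1 ⟩
    1 + indicator (marked h) ∎)

-- Counting by bijections

length-bijection : ∀ {A : Set} {xs ys : List A} (f g : A → A) → Unique xs → Unique ys →
  (∀ {x} → x ∈ xs → f x ∈ ys × g (f x) ≡ x) → (∀ {y} → y ∈ ys → g y ∈ xs × f (g y) ≡ y) →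
  length xs ≡ length ys
length-bijection {xs = xs} {ys} f g xs! ys! to from =
  trans (sym (length-map f xs)) (↭-length (∼bag⇒↭ (unique∧set⇒bag fxs! ys! (mk⇔ image preimage))))
  where
  fxs! : Unique (map f xs)
  fxs! = Unique.map⁻ (subst Unique
    (sym (trans (sym (map-∘ {g = g} {f = f} xs)) (map-id-local (All.tabulate (λ x∈ → proj₂ (to x∈)))))) xs!)
  image : ∀ {y} → y ∈ map f xs → y ∈ ys
  image y∈ with x , x∈ , refl ← ∈-map⁻ f y∈ = proj₁ (to x∈)
  preimage : ∀ {y} → y ∈ ys → y ∈ map f xs
  preimage y∈ = let gy∈ , fgy = from y∈ in subst (_∈ map f xs) fgy (∈-map⁺ f gy∈)

count-bijection : ∀ {k n} {s t : List Step → ℕ} {r q} (f g : List Step → List Step) →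
  (∀ {w} → IsDescent k n w → IsDescent k n (f w) × g (f w) ≡ w × (s w ≡ r → t (f w) ≡ q)) →
  (∀ {w} → IsDescent k n w → IsDescent k n (g w) × f (g w) ≡ w × (t w ≡ q → s (g w) ≡ r)) →
  #[ s ≡ r ]∈ 𝒫 k n ≡ #[ t ≡ q ]∈ 𝒫 k n
count-bijection {k} {n} {s} {t} {r} {q} f g to from =
  length-bijection f g (Unique.filter⁺ s? (𝒫-unique k n)) (Unique.filter⁺ t? (𝒫-unique k n))
    (λ w∈ → let w∈𝒫 , sw = ∈-filter⁻ s? {xs = 𝒫 k n} w∈
                fw , eq , st = to (∈𝒫⇒descent {k} {n} w∈𝒫)
            in ∈-filter⁺ t? (descent⇒∈𝒫 fw) (st sw) , eq)
    (λ w∈ → let w∈𝒫 , tw = ∈-filter⁻ t? {xs = 𝒫 k n} w∈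
                gw , eq , ts = from (∈𝒫⇒descent {k} {n} w∈𝒫)
            in ∈-filter⁺ s? (descent⇒∈𝒫 gw) (ts tw) , eq)
  where
  s? = λ w → s w ≟ r
  t? = λ w → t w ≟ q

count-cong : ∀ {k n} {s t : List Step → ℕ} {r q} →
  (∀ {w} → IsDescent k n w → s w ≡ r → t w ≡ q) →
  (∀ {w} → IsDescent k n w → t w ≡ q → s w ≡ r) →
  #[ s ≡ r ]∈ 𝒫 k n ≡ #[ t ≡ q ]∈ 𝒫 k n
count-cong to from = count-bijection id id (λ p → p , refl , to p) (λ p → p , refl , from p)

-- Equidistribution

-- A set of marked heights and a weight δ of a double descent, such that at every
-- node exactly one of the k+1 children is tested for being a leaf.
record Marking (k : ℕ) : Set where
  field
    marked : ℕ → Bool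
    δ      : ℕ
    once   : ∀ h → marks k marked h k + δ ≡ 1

  open Coding k marked public
  open Statistic δ public hiding (scan)

  statistic : List Step → ℕ
  statistic = scan k marked δ 0 0

open Marking using (statistic)

module _ {k : ℕ} (M N : Marking k) where

  private
    module M = Marking M
    module N = Marking N

  -- Decode with respect to M and encode with respect to N.
  recode : List Step → List Step
  recode w = N.encode (M.decode w) 0

  recode-descent : ∀ {n w} → IsDescent k n w → IsDescent k n (recode w)
  recode-descent {w = w} (p , eq) =
    N.encode-descent (M.decode w) ,
    trans (N.downs-encode (M.decode w)) (trans (M.size-decode p) eq)

  recode-statistic : ∀ {w} → Descent k 0 w → statistic N (recode w) ≡ statistic M w
  recode-statistic {w} p =
    trans (N.scan-encode N.once (M.decode w)) (M.topEdges-decode M.once p)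

recode-inverse : ∀ {k} (M N : Marking k) {w} → Descent k 0 w → recode N M (recode M N w) ≡ w
recode-inverse M N {w} p =
  trans (cong (λ t → M.encode t 0) (N.decode-encode (M.decode w))) (M.encode-decode p)
  where
  module M = Marking M
  module N = Marking N

statistic-equidistributed : ∀ {k} n (M N : Marking k) r →
  #[ statistic M ≡ r ]∈ 𝒫 k n ≡ #[ statistic N ≡ r ]∈ 𝒫 k n
statistic-equidistributed n M N r = count-bijection (recode M N) (recode N M) (go M N) (go N M)
  where
  go : ∀ {k} (M N : Marking k) {w} → IsDescent k n w →
    IsDescent k n (recode M N w) × recode N M (recode M N w) ≡ w
      × (statistic M w ≡ r → statistic N (recode M N w) ≡ r)
  go M N pn@(p , _) =
    recode-descent M N pn , recode-inverse M N p , trans (recode-statistic M N p)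

ddMarking : ∀ k → Marking k
ddMarking k = record { marked = noLevel ; δ = 1 ; once = λ h → cong (_+ 1) (no-marks h k) }
  where
  no-marks : ∀ h n → marks k noLevel h n ≡ 0
  no-marks h zero    = refl
  no-marks h (suc n) = no-marks h n

residueMarking : ∀ k .{{_ : NonZero k}} → Fin k → Marking k
residueMarking k i = record
  { marked = marked ; δ = 0 ; once = λ h → trans (+-identityʳ _) (marks-window h) }
  where open Residue k i

pkᵢ-dd : ∀ k n .{{_ : NonZero k}} (i : Fin k) r → #[ pkᵢ k i ≡ r ]∈ 𝒫 k n ≡ #[ dd ≡ r ]∈ 𝒫 k n
pkᵢ-dd k n i r = begin
  #[ pkᵢ k i ≡ r ]∈ 𝒫 k n
    ≡⟨ count-cong (λ (p , _) → trans (sym (count-peaks p))) (λ (p , _) → trans (count-peaks p)) ⟩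
  #[ statistic (residueMarking k i) ≡ r ]∈ 𝒫 k n
    ≡⟨ statistic-equidistributed n (residueMarking k i) (ddMarking k) r ⟩
  #[ statistic (ddMarking k) ≡ r ]∈ 𝒫 k n
    ≡⟨ count-cong {k} {n} (λ {w} _ → trans (dd-scan k 0 w)) (λ {w} _ → trans (sym (dd-scan k 0 w))) ⟩
  #[ dd ≡ r ]∈ 𝒫 k n ∎
  where
  open Residue k i
  open Peaks k residue? periodic using (count-peaks)

dd-pk : ∀ k n .{{_ : NonZero k}} .{{_ : NonZero n}} r → r ≤ n ∸ 1 →
  #[ dd ≡ r ]∈ 𝒫 k n ≡ #[ pk k ≡ n ∸ 1 ∸ r ]∈ 𝒫 k n
dd-pk k n r r≤ = count-cong
  (λ { {w} p refl → trans (sym (m+n∸n≡m (pk k w) (dd w))) (cong (_∸ dd w) (pk+dd k p)) })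
  (λ {w} p eq → begin
    dd w                       ≡⟨ m+n∸m≡n (pk k w) (dd w) ⟨
    pk k w + dd w ∸ pk k w     ≡⟨ cong₂ _∸_ (pk+dd k p) eq ⟩
    n ∸ 1 ∸ (n ∸ 1 ∸ r)        ≡⟨ m∸[m∸n]≡n r≤ ⟩
    r                          ∎)

mainTheorem4 : (k n : ℕ) .{{_ : NonZero k}} .{{_ : NonZero n}} →
    (r : ℕ) → r ≤ n ∸ 1 →
    ((i : Fin k) → #[ pkᵢ k i ≡ r ]∈ 𝒫 k n ≡ #[ pk k ≡ n ∸ 1 ∸ r ]∈ 𝒫 k n)
    × #[ dd ≡ r ]∈ 𝒫 k n ≡ #[ pk k ≡ n ∸ 1 ∸ r ]∈ 𝒫 k n
mainTheorem4 k n r r≤ = (λ i → trans (pkᵢ-dd k n i r) (dd-pk k n r r≤)) , dd-pk k n r r≤
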